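{- Let $G$ and $H$ be any binary games. Then $G \geqslant^-_{\mathcal{DB}} H$ if and only if $G \geqslant^-_{\mathcal{D}} H$.
   Context: A game is a finite two-player combinatorial game, defined recursively by $G=\{G^{\mathbf L}\mid G^{\mathbf R}\}$, where $G^{\mathbf L}$ and $G^{\mathbf R}$ are the finite sets of Left options and Right options, which are themselves games. The game $0=\{\cdot\mid\cdot\}$ has no options. The sum is $G+H=\{G^{\mathbf L}+H,\,G+H^{\mathbf L}\mid G^{\mathbf R}+H,\,G+H^{\mathbf R}\}$. Left and Right alternate moves. Under misère play, a player who cannot move on their turn wins. The misère outcome $o^-(G)$ is $\mathcal L$ (Left wins whoever starts), $\mathcal R$ (Right wins whoever starts), $\mathcal N$ (the first player wins) or $\mathcal P$ (the second player wins). Outcomes are partially ordered by $\mathcal R<\mathcal N<\mathcal L$ and $\mathcal R<\mathcal P<\mathcal L$, with $\mathcal N$ and $\mathcal P$ incomparable. For a set $\mathcal U$ of games and games $G,H$ (not necessarily in $\mathcal U$), $G\geqslant^-_{\mathcal U}H$ means $o^-(G+X)\geqslant o^-(H+X)$ for every $X\in\mathcal U$. A game is dicot if it is $0$, or if it has both Left and Right options and all of them are dicot. A game is binary if it has at most one Left option and at most one Right option, and all these options, if any, are binary. $\mathcal D$ is the set of all dicot games and $\mathcal{DB}$ is the set of all games that are both binary and dicot. -}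

module Defs where

open import Data.Bool.Base using (Bool; true; false; not; _∨_)
open import Data.List.Base using (List; []; _∷_; _++_; map; length)
open import Data.List.Relation.Unary.All using (All)
open import Data.Nat.Base using (_≤_)
open import Level using (0ℓ)
open import Relation.Binary.PropositionalEquality using (_≡_; _≢_; refl; cong; cong₂)
open import Relation.Unary using (Pred; _∩_)

infix  5 ⟨_∣_⟩
infixl 6 _+_
infix  4 _≤ᵒ_ _≥[_]_

-- The finite sets of options are represented by lists. Order and repetitions
-- in these lists affect neither outcomes nor, therefore, the relations _≥[ U ]_.
data Game : Set where
  ⟨_∣_⟩ : (ls rs : List Game) → Game

leftOptions rightOptions : Game → List Game
leftOptions  ⟨ ls ∣ rs ⟩ = ls
rightOptions ⟨ ls ∣ rs ⟩ = rs

𝟎 : Game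
𝟎 = ⟨ [] ∣ [] ⟩

-- gs +ˡ H is map (_+ H) gs and G +ʳ hs is map (G +_) hs, unfolded for the
-- termination checker; see leftOptions-+ and rightOptions-+.
_+_  : Game → Game → Game
_+ˡ_ : List Game → Game → List Game
_+ʳ_ : Game → List Game → List Game

G@(⟨ gl ∣ gr ⟩) + H@(⟨ hl ∣ hr ⟩) =
  ⟨ (gl +ˡ H) ++ (G +ʳ hl) ∣ (gr +ˡ H) ++ (G +ʳ hr) ⟩

[]       +ˡ H = []
(g ∷ gs) +ˡ H = (g + H) ∷ (gs +ˡ H)

G +ʳ []       = []
G +ʳ (h ∷ hs) = (G + h) ∷ (G +ʳ hs)

+ˡ≡map : ∀ gs H → gs +ˡ H ≡ map (_+ H) gs
+ˡ≡map []       H = refl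
+ˡ≡map (g ∷ gs) H = cong (g + H ∷_) (+ˡ≡map gs H)

+ʳ≡map : ∀ G hs → G +ʳ hs ≡ map (G +_) hs
+ʳ≡map G []       = refl
+ʳ≡map G (h ∷ hs) = cong (G + h ∷_) (+ʳ≡map G hs)

leftOptions-+ : ∀ G H → leftOptions (G + H) ≡
                map (_+ H) (leftOptions G) ++ map (G +_) (leftOptions H)
leftOptions-+ G@(⟨ gl ∣ _ ⟩) H@(⟨ hl ∣ _ ⟩) = cong₂ _++_ (+ˡ≡map gl H) (+ʳ≡map G hl)

rightOptions-+ : ∀ G H → rightOptions (G + H) ≡
                 map (_+ H) (rightOptions G) ++ map (G +_) (rightOptions H)
rightOptions-+ G@(⟨ _ ∣ gr ⟩) H@(⟨ _ ∣ hr ⟩) = cong₂ _++_ (+ˡ≡map gr H) (+ʳ≡map G hr)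

-- Does Left (Right) win under misère play when she (he) moves first? A player
-- unable to move wins; otherwise she needs a move to a game that the opponent,
-- moving first there, does not win.
leftWinsFirst rightWinsFirst : Game → Bool
anyRightLoses anyLeftLoses   : List Game → Bool

leftWinsFirst ⟨ []          ∣ _ ⟩ = true
leftWinsFirst ⟨ gl@(_ ∷ _) ∣ _ ⟩ = anyRightLoses gl

rightWinsFirst ⟨ _ ∣ []          ⟩ = true
rightWinsFirst ⟨ _ ∣ gr@(_ ∷ _) ⟩ = anyLeftLoses gr

anyRightLoses []       = false
anyRightLoses (g ∷ gs) = not (rightWinsFirst g) ∨ anyRightLoses gs

anyLeftLoses []       = false
anyLeftLoses (g ∷ gs) = not (leftWinsFirst g) ∨ anyLeftLoses gs

data Outcome : Set where
  𝓛 𝓡 𝓝 𝓟 : Outcome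

outcome⁻ : Game → Outcome
outcome⁻ G with leftWinsFirst G | rightWinsFirst G
... | true  | false = 𝓛
... | false | true  = 𝓡
... | true  | true  = 𝓝
... | false | false = 𝓟

data _≤ᵒ_ : Outcome → Outcome → Set where
  ≤ᵒ-refl : ∀ {o} → o ≤ᵒ o
  𝓡-min   : ∀ {o} → 𝓡 ≤ᵒ o
  𝓛-max   : ∀ {o} → o ≤ᵒ 𝓛

_≥[_]_ : Game → Pred Game 0ℓ → Game → Set
G ≥[ U ] H = ∀ X → U X → outcome⁻ (H + X) ≤ᵒ outcome⁻ (G + X)

data Dicot : Game → Set where
  dicot-𝟎    : Dicot 𝟎
  dicot-both : ∀ {ls rs} → ls ≢ [] → rs ≢ [] →
               All Dicot ls → All Dicot rs → Dicot ⟨ ls ∣ rs ⟩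

-- Every game with at most one Left and one Right option, hereditarily as sets,
-- has a representation by lists of length at most one.
data Binary : Game → Set where
  binary : ∀ {ls rs} → length ls ≤ 1 → length rs ≤ 1 →
           All Binary ls → All Binary rs → Binary ⟨ ls ∣ rs ⟩

𝓓 𝓓𝓑 : Pred Game 0ℓ
𝓓  = Dicot
𝓓𝓑 = Binary ∩ Dicot

{-# OPTIONS --safe #-}
module Submission where

open import Defs
open import Data.Bool.Base using (Bool; true; false)
open import Data.List.Base using (List; []; _∷_; _++_; map; length)
open import Data.List.Membership.Propositional using (_∈_)
open import Data.List.Membership.Propositional.Properties
  using (∈-++⁺ˡ; ∈-++⁺ʳ; ∈-++⁻; ∈-map⁺; ∈-map⁻)
open import Data.List.Relation.Unary.All as All using (All; []; _∷_)
open import Data.List.Relation.Unary.Any using (here; there)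
open import Data.Nat.Base using (_≤_; z≤n; s≤s)
open import Data.Product.Base using (_×_; _,_; proj₁; proj₂; ∃-syntax)
open import Data.Sum.Base using (_⊎_; inj₁; inj₂)
open import Function.Bundles using (_⇔_; mk⇔)
open import Relation.Binary.PropositionalEquality
  using (_≡_; _≢_; refl; sym; trans; cong₂; subst)
open import Relation.Nullary using (¬_; contradiction)

-- If G does not dominate H over dicots, then either 𝟎 tells them apart or some
-- move of Left in H to h (or, dually, of Right in G) has no good counterpart:
-- neither does the Left option g of G dominate h, nor G the Right option h' of h.
-- By induction there are binary dicots X telling g from h and Y telling G from
-- h', and then {Y | X} tells G from H. Since G and H are binary, one X and one Y
-- suffice, so {Y | X} is binary again. When g or h' does not exist, X or Y is an
-- option of the adjoint of h or G; the adjoint of a binary game is a binary dicot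
-- whose sum with that game is a 𝓟-position.

-- Misère play, uniformly in the player.

data Player : Set where
  left right : Player

data _opposes_ : Player → Player → Set where
  lr : left opposes right
  rl : right opposes left

private variable
  p q     : Player
  G H X Y g h : Game

flip : p opposes q → q opposes p
flip lr = rl
flip rl = lr

options : Player → Game → List Game
options left  = leftOptions
options right = rightOptions

winsFirst : Player → Game → Bool
winsFirst left  = leftWinsFirst
winsFirst right = rightWinsFirst

-- A record, so that the player and the game can be inferred from the type; likewise `Loses`.
record Wins (p : Player) (G : Game) : Set where
  constructor wins
  field winsFirst≡true : winsFirst p G ≡ true

record Loses (p : Player) (G : Game) : Set where
  constructor loses
  field winsFirst≡false : winsFirst p G ≡ false

wins-or-loses : ∀ p G → Wins p G ⊎ Loses p G
wins-or-loses p G with winsFirst p G in eq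
... | true  = inj₁ (wins eq)
... | false = inj₂ (loses eq)

¬wins×loses : Wins p G → ¬ Loses p G
¬wins×loses (wins w) (loses l) with () ← trans (sym w) l

loses-contra : (Wins p G → Wins q H) → Loses q H → Loses p G
loses-contra {p} {G} f l with wins-or-loses p G
... | inj₁ w  = contradiction l (¬wins×loses (f w))
... | inj₂ l′ = l′

anyRightLoses⁺ : ∀ {gs} → g ∈ gs → Loses right g → anyRightLoses gs ≡ true
anyRightLoses⁺ (here refl) (loses l) rewrite l = refl
anyRightLoses⁺ {gs = k ∷ _} (there i) l with rightWinsFirst k
... | true  = anyRightLoses⁺ i l
... | false = refl

anyLeftLoses⁺ : ∀ {gs} → g ∈ gs → Loses left g → anyLeftLoses gs ≡ true
anyLeftLoses⁺ (here refl) (loses l) rewrite l = refl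
anyLeftLoses⁺ {gs = k ∷ _} (there i) l with leftWinsFirst k
... | true  = anyLeftLoses⁺ i l
... | false = refl

anyRightLoses⁻ : ∀ gs → anyRightLoses gs ≡ true → ∃[ g ] g ∈ gs × Loses right g
anyRightLoses⁻ (k ∷ gs) w with rightWinsFirst k in eq
... | false = k , here refl , loses eq
... | true  = let g , i , l = anyRightLoses⁻ gs w in g , there i , l

anyLeftLoses⁻ : ∀ gs → anyLeftLoses gs ≡ true → ∃[ g ] g ∈ gs × Loses left g
anyLeftLoses⁻ (k ∷ gs) w with leftWinsFirst k in eq
... | false = k , here refl , loses eq
... | true  = let g , i , l = anyLeftLoses⁻ gs w in g , there i , l

wins-end : ∀ p → options p G ≡ [] → Wins p G
wins-end {⟨ [] ∣ _ ⟩} left  _ = wins refl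
wins-end {⟨ _ ∣ [] ⟩} right _ = wins refl

wins-move : p opposes q → g ∈ options p G → Loses q g → Wins p G
wins-move {G = ⟨ _ ∷ _ ∣ _ ⟩} lr i l = wins (anyRightLoses⁺ i l)
wins-move {G = ⟨ _ ∣ _ ∷ _ ⟩} rl i l = wins (anyLeftLoses⁺ i l)

wins⁻ : p opposes q → Wins p G →
        options p G ≡ [] ⊎ (∃[ g ] g ∈ options p G × Loses q g)
wins⁻ {G = ⟨ [] ∣ _ ⟩}         lr (wins w) = inj₁ refl
wins⁻ {G = ⟨ gl@(_ ∷ _) ∣ _ ⟩} lr (wins w) = inj₂ (anyRightLoses⁻ gl w)
wins⁻ {G = ⟨ _ ∣ [] ⟩}         rl (wins w) = inj₁ refl
wins⁻ {G = ⟨ _ ∣ gr@(_ ∷ _) ⟩} rl (wins w) = inj₂ (anyLeftLoses⁻ gr w)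

loses-move : p opposes q → Loses p G → g ∈ options p G → Wins q g
loses-move {q = q} {g = g} o l i with wins-or-loses q g
... | inj₁ w  = w
... | inj₂ l′ = contradiction l (¬wins×loses (wins-move o i l′))

-- Some option `h` must exist because under misère play a player without a move wins.
loses-all : p opposes q → h ∈ options p G →
            (∀ {g} → g ∈ options p G → Wins q g) → Loses p G
loses-all {p = p} {G = G} o i all with wins-or-loses p G
... | inj₂ l = l
... | inj₁ w with wins⁻ o w
...   | inj₁ eq with () ← subst (_ ∈_) eq i
...   | inj₂ (_ , j , l) = contradiction l (¬wins×loses (all j))

-- Moves in a sum.

options-+ : ∀ p G H →
            options p (G + H) ≡ map (_+ H) (options p G) ++ map (G +_) (options p H)
options-+ left  = leftOptions-+
options-+ right = rightOptions-+

moveˡ : ∀ p → g ∈ options p G → g + X ∈ options p (G + X)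
moveˡ {G = G} {X = X} p i =
  subst (_ ∈_) (sym (options-+ p G X)) (∈-++⁺ˡ (∈-map⁺ (_+ X) i))

moveʳ : ∀ p → h ∈ options p X → G + h ∈ options p (G + X)
moveʳ {X = X} {G = G} p i =
  subst (_ ∈_) (sym (options-+ p G X)) (∈-++⁺ʳ _ (∈-map⁺ (G +_) i))

data Move (p : Player) (G X : Game) : Game → Set where
  inˡ : g ∈ options p G → Move p G X (g + X)
  inʳ : h ∈ options p X → Move p G X (G + h)

move⁻ : ∀ p G X → h ∈ options p (G + X) → Move p G X h
move⁻ p G X i
  with ∈-++⁻ (map (_+ X) (options p G)) (subst (_ ∈_) (options-+ p G X) i)
... | inj₁ j with ∈-map⁻ (_+ X) j
...   | _ , k , refl = inˡ k
move⁻ p G X i | inj₂ j with ∈-map⁻ (G +_) j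
...   | _ , k , refl = inʳ k

wins-end+𝟎 : ∀ p → options p G ≡ [] → Wins p (G + 𝟎)
wins-end+𝟎 {G} p eq =
  wins-end p
    (trans (options-+ p G 𝟎) (cong₂ (λ gs hs → map _ gs ++ map _ hs) eq (options-𝟎 p)))
  where
  options-𝟎 : ∀ p → options p 𝟎 ≡ []
  options-𝟎 left  = refl
  options-𝟎 right = refl

-- Games with one option for each player.

node : p opposes q → Game → Game → Game
node lr A B = ⟨ A ∷ [] ∣ B ∷ [] ⟩
node rl A B = ⟨ B ∷ [] ∣ A ∷ [] ⟩

options-node₁ : ∀ (o : p opposes q) A B → options p (node o A B) ≡ A ∷ []
options-node₁ lr _ _ = refl
options-node₁ rl _ _ = refl

options-node₂ : ∀ (o : p opposes q) A B → options q (node o A B) ≡ B ∷ []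
options-node₂ lr _ _ = refl
options-node₂ rl _ _ = refl

move-node₁ : ∀ (o : p opposes q) → G + X ∈ options p (G + node o X Y)
move-node₁ {p} {X = X} {Y = Y} o =
  moveʳ p (subst (X ∈_) (sym (options-node₁ o X Y)) (here refl))

move-node₂ : ∀ (o : p opposes q) → G + Y ∈ options q (G + node o X Y)
move-node₂ {q = q} {Y = Y} {X = X} o =
  moveʳ q (subst (Y ∈_) (sym (options-node₂ o X Y)) (here refl))

-- If `p` moves in `G`, then `q` answers with `Y` in the other summand; if `p` moves to `G + X`,
-- then `q` wins by assumption.
loses-node₁ : (o : p opposes q) →
              (∀ {g} → g ∈ options p G → Loses p (g + Y)) → Wins q (G + X) →
              Loses p (G + node o X Y)
loses-node₁ {p} {q} {G} {Y} {X} o refute win = loses-all o (move-node₁ o) reply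
  where
  reply : ∀ {k} → k ∈ options p (G + node o X Y) → Wins q k
  reply i with move⁻ p G (node o X Y) i
  ... | inˡ j = wins-move (flip o) (move-node₂ o) (refute j)
  ... | inʳ j with subst (_ ∈_) (options-node₁ o X Y) j
  ...   | here refl = win

node-flip : ∀ (o : p opposes q) A B → node (flip o) B A ≡ node o A B
node-flip lr _ _ = refl
node-flip rl _ _ = refl

loses-node₂ : (o : p opposes q) →
              (∀ {g} → g ∈ options q G → Loses q (g + X)) → Wins p (G + Y) →
              Loses q (G + node o X Y)
loses-node₂ {G = G} {X = X} {Y = Y} o refute win =
  subst (λ Z → Loses _ (G + Z)) (node-flip o X Y) (loses-node₁ (flip o) refute win)

𝓓𝓑-𝟎 : 𝓓𝓑 𝟎
𝓓𝓑-𝟎 = binary z≤n z≤n [] [] , dicot-𝟎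

𝓓𝓑-node : (o : p opposes q) → 𝓓𝓑 X → 𝓓𝓑 Y → 𝓓𝓑 (node o X Y)
𝓓𝓑-node lr (bx , dx) (by , dy) =
  binary (s≤s z≤n) (s≤s z≤n) (bx ∷ []) (by ∷ []) ,
  dicot-both (λ ()) (λ ()) (dx ∷ []) (dy ∷ [])
𝓓𝓑-node rl x y = 𝓓𝓑-node lr y x

-- Binary games with the options of both players treated uniformly, in a form
-- on which recursion is structural.
data Bin (G : Game) : Set
data AtMostOne (gs : List Game) : Set

data Bin G where
  bin : (∀ p → AtMostOne (options p G)) → Bin G

data AtMostOne gs where
  none : gs ≡ [] → AtMostOne gs
  one  : gs ≡ g ∷ [] → Bin g → AtMostOne gs

binary⇒bin : Binary G → Bin G
atMostOne  : ∀ {gs} → length gs ≤ 1 → All Binary gs → AtMostOne gs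

binary⇒bin (binary l≤1 r≤1 bl br) = bin λ where
  left  → atMostOne l≤1 bl
  right → atMostOne r≤1 br

atMostOne _        []       = none refl
atMostOne _        (b ∷ []) = one refl (binary⇒bin b)
atMostOne (s≤s ()) (_ ∷ _ ∷ _)

-- Blocking games and the adjoint.

∈[] : {A : Set} → g ∈ [] → A
∈[] ()

∈[-] : (P : Game → Set) → h ∈ g ∷ [] → P g → P h
∈[-] P (here refl) x = x

-- With `h` equal to `G` this supplies half of an adjoint, otherwise half of a separating game.
Blocks : Player → Game → Game → Set
Blocks p h G =
  ∃[ X ] 𝓓𝓑 X × Wins p (h + X) × (∀ {g} → g ∈ options p G → Loses p (g + X))

-- The game node lr below is the adjoint of G.
adjoint       : Bin G → ∃[ X ] 𝓓𝓑 X × (∀ p → Loses p (G + X))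
-- The adjoint of an option `g` works: `p` moves to `g + X`, which either player loses when
-- starting. Without an option, `𝟎` works, since `p` is stuck and so wins.
adjoint-block : p opposes q → AtMostOne (options p G) → Blocks p G G

adjoint (bin options-G) =
  let X , dx , wx , lx = adjoint-block rl (options-G right)
      Y , dy , wy , ly = adjoint-block lr (options-G left)
  in node lr X Y , 𝓓𝓑-node lr dx dy , λ where
       left  → loses-node₁ lr ly wx
       right → loses-node₂ lr lx wy

adjoint-block {p} o (none eq) =
  𝟎 , 𝓓𝓑-𝟎 , wins-end+𝟎 p eq , λ i → ∈[] (subst (_ ∈_) eq i)
adjoint-block {p} {q} o (one {g} eq b) =
  let X , dx , lx = adjoint b
  in X , dx ,
     wins-move o (moveˡ p (subst (_ ∈_) (sym eq) (here refl))) (lx q) ,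
     λ i → ∈[-] (λ g → Loses p (g + X)) (subst (_ ∈_) eq i) (lx p)

-- Domination over dicots and separation by binary dicots.

Dominates : Player → Game → Game → Set
Dominates p G H = ∀ {X} → Dicot X → Wins p (H + X) → Wins p (G + X)

Separated : Player → Game → Game → Set
Separated p G H = ∃[ X ] 𝓓𝓑 X × Wins p (H + X) × Loses p (G + X)

-- The first alternative matches the move to `h` by a move in `G`; the second reverses it through a
-- reply of `q`.
Counter : Player → Player → Game → Game → Game → Set
Counter p q G H h = (∃[ g ] g ∈ options p G × Dominates q h g)
                  ⊎ (∃[ k ] k ∈ options q h × Dominates p G k)

-- The proviso concerns `𝟎` alone because any other dicot gives both players a move.
Maintains : Player → Player → Game → Game → Set
Maintains p q G H =
  (Wins p (H + 𝟎) → Wins p (G + 𝟎)) × (∀ {h} → h ∈ options p H → Counter p q G H h)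

nonempty : ∀ {xs : List Game} → xs ≢ [] → ∃[ x ] x ∈ xs
nonempty {[]}    ne = contradiction refl ne
nonempty {x ∷ _} ne = x , here refl

Dicot-rec : (P : Game → Set) → P 𝟎 →
            (∀ {X} → Dicot X → (∀ p → ∃[ x ] x ∈ options p X) →
             (∀ p → All P (options p X)) → P X) →
            ∀ {X} → Dicot X → P X
Dicot-rec P base step = rec
  where
  rec  : Dicot X → P X
  recs : ∀ {xs} → All Dicot xs → All P xs
  rec dicot-𝟎 = base
  rec d@(dicot-both l≢[] r≢[] dl dr) = step d
    (λ where left → nonempty l≢[] ; right → nonempty r≢[])
    (λ where left → recs dl ; right → recs dr)
  recs []       = []
  recs (d ∷ ds) = rec d ∷ recs ds

maintains⇒dominates : p opposes q → Maintains p q G H → Maintains q p H G → Dominates p G H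
maintains⇒dominates o m m′ d = Dicot-rec P (λ _ m _ → proj₁ m) step d o m m′
  where
  P : Game → Set
  P X = ∀ {p q G H} → p opposes q → Maintains p q G H → Maintains q p H G →
        Wins p (H + X) → Wins p (G + X)

  step : ∀ {X} → Dicot X → (∀ p → ∃[ x ] x ∈ options p X) →
         (∀ p → All P (options p X)) → P X
  step {X} d ne ih {p} {q} {G} {H} o m m′ w with wins⁻ o w
  ... | inj₁ eq with () ← subst (_ ∈_) eq (moveʳ {G = H} p (proj₂ (ne p)))
  ... | inj₂ (_ , i , l) with move⁻ p H X i
  -- A move in `X` passes the turn to `q`, so the induction hypothesis is applied with players and
  -- games interchanged; hence the two `Maintains` assumptions.
  ...   | inʳ j = wins-move o (moveʳ p j)
                    (loses-contra (All.lookup (ih p) j (flip o) m′ m) l)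
  ...   | inˡ j with proj₂ m j
  ...   | inj₁ (_ , k , dom) = wins-move o (moveˡ p k) (loses-contra (dom d) l)
  -- Here `q` loses after the move to `h`, so every reply leaves `p` a win, in particular the reply
  -- that `G` dominates.
  ...   | inj₂ (_ , k , dom) = dom d (loses-move (flip o) l (moveˡ q k))

-- If X separates with p moving first, then {A | X} does so with q moving first,
-- where A is the adjoint of the q-option of H (or 𝟎, if there is none).
separated-flip : p opposes q → Bin H → Separated p G H → Separated q H G
separated-flip {q = q} o (bin options-H) (X , dx , w , l) =
  let A , da , _ , la = adjoint-block (flip o) (options-H q)
  in node o A X , 𝓓𝓑-node o da dx ,
     wins-move (flip o) (move-node₂ o) l , loses-node₂ o la w

-- In `H + node o Y X`, `p` moves to `h`; a move of `q` in `h` is answered with `Y`, and a move to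
-- `X` leaves `p` a win. In `G + node o Y X`, a move of `p` in `G` is answered with `X`, and a move
-- to `Y` leaves `q` a win.
blocks⇒separated : p opposes q → h ∈ options p H → Blocks q G h → Blocks p h G →
                   Separated p G H
blocks⇒separated {p} o i (Y , dy , wy , ly) (X , dx , wx , lx) =
  node o Y X , 𝓓𝓑-node o dy dx ,
  wins-move o (moveˡ p i) (loses-node₂ o ly wx) , loses-node₁ o lx wy

-- Failure of domination with `p` starting is delivered with `q` starting, the form that `Blocks`
-- asks for. The recursion descends to options of both games, or to one game and an option of an
-- option of the other.
dominates-or-separated : p opposes q → Bin G → Bin H →
                         Dominates p G H ⊎ Separated q H G
maintains-or-separated : p opposes q → Bin G → Bin H →
                         Maintains p q G H ⊎ Separated p G H
countered-or-blocked   : p opposes q → Bin h → AtMostOne (options p G) →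
                         (∃[ g ] g ∈ options p G × Dominates q h g) ⊎ Blocks p h G

dominates-or-separated o bG bH with maintains-or-separated o bG bH
... | inj₂ s = inj₂ (separated-flip o bH s)
... | inj₁ m with maintains-or-separated (flip o) bH bG
...   | inj₂ s  = inj₂ s
...   | inj₁ m′ = inj₁ (maintains⇒dominates o m m′)

maintains-or-separated {p} {q} {G} {H} o bG@(bin options-G) (bin options-H) =
  proviso (wins-or-loses p (G + 𝟎)) (wins-or-loses p (H + 𝟎))
  where
  maintained : (Wins p (H + 𝟎) → Wins p (G + 𝟎)) → AtMostOne (options p H) →
               Maintains p q G H ⊎ Separated p G H
  maintained pr (none eq) = inj₁ (pr , λ i → ∈[] (subst (_ ∈_) eq i))
  maintained pr (one eq bh@(bin options-h))
    with countered-or-blocked o bh (options-G p)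
  ... | inj₁ c = inj₁ (pr , λ i → ∈[-] (Counter p q G H) (subst (_ ∈_) eq i) (inj₁ c))
  -- Reversal is the same question with the players exchanged, `G` in the place of `h` and `h` in
  -- that of `G`.
  ... | inj₂ x with countered-or-blocked (flip o) bG (options-h q)
  ...   | inj₁ c = inj₁ (pr , λ i → ∈[-] (Counter p q G H) (subst (_ ∈_) eq i) (inj₂ c))
  ...   | inj₂ y = inj₂ (blocks⇒separated o (subst (_ ∈_) (sym eq) (here refl)) y x)

  proviso : Wins p (G + 𝟎) ⊎ Loses p (G + 𝟎) → Wins p (H + 𝟎) ⊎ Loses p (H + 𝟎) →
            Maintains p q G H ⊎ Separated p G H
  -- When the proviso fails, `𝟎` itself separates.
  proviso (inj₂ l) (inj₁ w) = inj₂ (𝟎 , 𝓓𝓑-𝟎 , w , l)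
  proviso (inj₁ w) _        = maintained (λ _ → w) (options-H p)
  proviso (inj₂ _) (inj₂ l) =
    maintained (λ w → contradiction l (¬wins×loses w)) (options-H p)

countered-or-blocked {p} {q} o bh@(bin options-h) (none eq) =
  -- No option of `G` has to be refuted, so any binary dicot `X` with `p` winning `h + X` will do.
  let X , dx , w , _ = adjoint-block o (options-h p)
  in inj₂ (X , dx , w , λ i → ∈[] (subst (_ ∈_) eq i))
countered-or-blocked {p} {q} {h} o bh (one eq bg) with dominates-or-separated (flip o) bh bg
... | inj₁ d = inj₁ (_ , subst (_ ∈_) (sym eq) (here refl) , d)
... | inj₂ (X , dx , w , l) = inj₂
  (X , dx , w , λ i → ∈[-] (λ g → Loses p (g + X)) (subst (_ ∈_) eq i) l)

-- The outcome order as a product order on the results with Left and with Right starting.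

outcome-mono : (Wins left H → Wins left G) → (Wins right G → Wins right H) →
               outcome⁻ H ≤ᵒ outcome⁻ G
outcome-mono {H} {G} f f′ with leftWinsFirst H in hl | rightWinsFirst H in hr
                            | leftWinsFirst G in gl | rightWinsFirst G in gr
... | _     | _     | true  | false = 𝓛-max
... | false | true  | _     | _     = 𝓡-min
... | true  | true  | true  | true  = ≤ᵒ-refl
... | false | false | false | false = ≤ᵒ-refl
... | true  | _     | false | _     = contradiction (loses gl) (¬wins×loses (f (wins hl)))
... | _     | false | _     | true  = contradiction (loses hr) (¬wins×loses (f′ (wins gr)))

outcome-≰-left : Wins left H → Loses left G → ¬ (outcome⁻ H ≤ᵒ outcome⁻ G)
outcome-≰-left {H} {G} (wins w) (loses l) le
  rewrite w | l with rightWinsFirst H | rightWinsFirst G | le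
... | true  | true  | ()
... | true  | false | ()
... | false | true  | ()
... | false | false | ()

outcome-≰-right : Wins right G → Loses right H → ¬ (outcome⁻ H ≤ᵒ outcome⁻ G)
outcome-≰-right {G} {H} (wins w) (loses l) le
  rewrite w | l with leftWinsFirst H | leftWinsFirst G | le
... | true  | true  | ()
... | true  | false | ()
... | false | true  | ()
... | false | false | ()

-- A failure of either half of the comparison has a witness in `𝓓𝓑`, which contradicts the
-- hypothesis; otherwise both halves hold over all dicots.
𝓓𝓑⇒𝓓 : Bin G → Bin H → G ≥[ 𝓓𝓑 ] H → G ≥[ 𝓓 ] H
𝓓𝓑⇒𝓓 bG bH ge with dominates-or-separated lr bG bH | dominates-or-separated rl bH bG
... | inj₂ (X , dx , w , l) | _ = contradiction (ge X dx) (outcome-≰-right w l)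
... | _ | inj₂ (X , dx , w , l) = contradiction (ge X dx) (outcome-≰-left w l)
... | inj₁ d | inj₁ d′ = λ X dx → outcome-mono (d dx) (d′ dx)

theorem3p24 : (G H : Game) → Binary G → Binary H → (G ≥[ 𝓓𝓑 ] H) ⇔ (G ≥[ 𝓓 ] H)
theorem3p24 G H bG bH =
  mk⇔ (𝓓𝓑⇒𝓓 (binary⇒bin bG) (binary⇒bin bH)) (λ ge X dx → ge X (proj₂ dx))
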